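{- Let $T$ be a locally finite rooted tree, $\ell$ a length function and $\chi$ a capacity function on $T$. For all non-negative integers $n\ge m$ with $n<N_{T,\chi}$, $$n!_{(T,\ell,\chi)}\ \ge\ (n-m)!_{(T,\ell,\chi)}+m!_{(T,\ell,\chi)}.$$
   Context: $T$ has root $\mathfrak r$ and edges oriented away from the root; a length function is $\ell:E(T)\to\mathbb R_{+}$ with (strictly) positive values. A leaf is a vertex $v\ne\mathfrak r$ of valence one, or $\mathfrak r$ if $T=\{\mathfrak r\}$; $L(T)$ is the set of leaves. A capacity function is $\chi:L(T)\to\{1,2,\dots\}\cup\{\infty\}$. $\mathrm{br}(v)$ is the number of children of $v$; $v$ is branching if $\mathrm{br}(v)\ge2$; $\mathscr B(T)$ is the set of branching vertices. $\partial T$ is the set of infinite oriented paths from $\mathfrak r$; $\widetilde\partial T$ is the union of $\partial T$ and the set of oriented paths from $\mathfrak r$ to a leaf. For $\rho,\tau\in\widetilde\partial T$ (distinct if both in $\partial T$), $\langle\rho,\tau\rangle$ is the sum of $\ell(e)$ over the common edges. Factorials: choose $\rho_0\in\widetilde\partial T$ arbitrarily; given $\rho_0,\dots,\rho_{n-1}$, choose $\rho_n$ minimizing $\sum_{j<n}\langle\rho,\rho_j\rangle$ among those $\rho\in\widetilde\partial T$ such that either $\rho\in\partial T$ was not chosen before, or $\rho$ ends at a leaf $v$ and was chosen strictly fewer than $\chi(v)$ times before. Then $n!_{(T,\ell,\chi)}:=\sum_{j<n}\langle\rho_n,\rho_j\rangle$. These numbers are independent of the choices, and are defined exactly for $0\le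 n<N_{T,\chi}$, where $$N_{T,\chi}:=1+\sum_{v\in\mathscr B(T)}(\mathrm{br}(v)-1)+\sum_{v\in L(T)}(\chi(v)-1)\in\{1,2,\dots\}\cup\{\infty\}.$$ -}

module Defs where

open import Data.Nat as ℕ using (ℕ; suc)
import Data.Nat.Properties as ℕ
open import Data.Fin using (Fin)
open import Data.List as List using (List; []; _∷_)
open import Data.List.Membership.Propositional using (_∈_)
open import Data.List.Relation.Unary.Unique.Propositional using (Unique)
open import Data.Product using (Σ; ∃; ∃₂; ∃!; _×_; _,_)
open import Data.Rational as ℚ using (ℚ; 0ℚ; ½; ∣_∣)
import Data.Rational.Properties as ℚ
open import Data.Rational.Solver using (module +-*-Solver)
open import Data.Refinement using (Refinement-syntax; value)
open import Data.Sum using (_⊎_)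
open import Data.Vec as Vec using (Vec; []; _∷_; lookup)
open import Data.Vec.Relation.Binary.Pointwise.Inductive using (Pointwise)
open import Data.Vec.Relation.Unary.Any using (Any)
open import Data.Empty using (⊥)
open import Data.Unit using (⊤)
open import Function using (_∘_; _⇔_)
open import Relation.Nullary using (¬_)
open import Relation.Nullary.Construct.Add.Supremum using (_⁺; [_]; ⊤⁺)
open import Relation.Binary.PropositionalEquality using (_≡_; _≢_; refl; sym; trans; cong; subst)
import Relation.Binary.Construct.Add.Supremum.NonStrict as AddSup≤
import Relation.Binary.Construct.Add.Supremum.Strict as AddSup<

-- The real numbers are the Cauchy sequences of rationals, with _≈ℝ_ as equality.

Cauchy : (ℕ → ℚ) → Set
Cauchy x = ∀ ε → 0ℚ ℚ.< ε →
  ∃ λ N → ∀ i j → N ℕ.≤ i → N ℕ.≤ j → ∣ x i ℚ.- x j ∣ ℚ.< ε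

record ℝ : Set where
  constructor mkℝ
  field
    seq    : ℕ → ℚ
    cauchy : Cauchy seq
open ℝ public

infix 4 _≤ℝ_ _<ℝ_ _≈ℝ_
infixl 6 _+ℝ_

_≤ℝ_ : ℝ → ℝ → Set
x ≤ℝ y = ∀ ε → 0ℚ ℚ.< ε → ∃ λ N → ∀ i → N ℕ.≤ i → seq x i ℚ.≤ seq y i ℚ.+ ε

_<ℝ_ : ℝ → ℝ → Set
x <ℝ y = ∃ λ ε → 0ℚ ℚ.< ε × ∃ λ N → ∀ i → N ℕ.≤ i → seq x i ℚ.+ ε ℚ.≤ seq y i

_≈ℝ_ : ℝ → ℝ → Set
x ≈ℝ y = x ≤ℝ y × y ≤ℝ x

0ℝ : ℝ
0ℝ = mkℝ (λ _ → 0ℚ) (λ ε ε>0 → 0 , λ _ _ _ _ → ε>0)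

halve : ∀ ε → 0ℚ ℚ.< ε → ∃ λ δ → 0ℚ ℚ.< δ × δ ℚ.+ δ ≡ ε
halve ε ε>0 = ½ ℚ.* ε
  , subst (ℚ._< ½ ℚ.* ε) (ℚ.*-zeroʳ ½) (ℚ.*-monoʳ-<-pos ½ ε>0)
  , trans (sym (ℚ.*-distribʳ-+ ε ½ ½)) (ℚ.*-identityˡ ε)

+-dist-< : ∀ a b c d δ {ε} → δ ℚ.+ δ ≡ ε → ∣ a ℚ.- c ∣ ℚ.< δ → ∣ b ℚ.- d ∣ ℚ.< δ →
           ∣ (a ℚ.+ b) ℚ.- (c ℚ.+ d) ∣ ℚ.< ε
+-dist-< a b c d δ {ε} δ+δ≡ε a-c<δ b-d<δ = begin-strict
  ∣ (a ℚ.+ b) ℚ.- (c ℚ.+ d) ∣     ≡⟨ cong ∣_∣ (regroup a b c d) ⟩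
  ∣ (a ℚ.- c) ℚ.+ (b ℚ.- d) ∣     ≤⟨ ℚ.∣p+q∣≤∣p∣+∣q∣ (a ℚ.- c) (b ℚ.- d) ⟩
  ∣ a ℚ.- c ∣ ℚ.+ ∣ b ℚ.- d ∣     <⟨ ℚ.+-mono-< a-c<δ b-d<δ ⟩
  δ ℚ.+ δ                         ≡⟨ δ+δ≡ε ⟩
  ε                               ∎
  where
  open ℚ.≤-Reasoning
  open +-*-Solver
  regroup : ∀ a b c d → (a ℚ.+ b) ℚ.- (c ℚ.+ d) ≡ (a ℚ.- c) ℚ.+ (b ℚ.- d)
  regroup = solve 4 (λ a b c d → (a :+ b) :- (c :+ d) := (a :- c) :+ (b :- d)) refl

+-cauchy : ∀ {x y} → Cauchy x → Cauchy y → Cauchy (λ i → x i ℚ.+ y i)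
+-cauchy {x} {y} cx cy ε ε>0 with halve ε ε>0
... | δ , δ>0 , δ+δ≡ε with cx δ δ>0 | cy δ δ>0
... | N₁ , p | N₂ , q = N₁ ℕ.⊔ N₂ , λ i j N≤i N≤j →
  +-dist-< (x i) (y i) (x j) (y j) δ δ+δ≡ε
    (p i j (ℕ.m⊔n≤o⇒m≤o N₁ N₂ N≤i) (ℕ.m⊔n≤o⇒m≤o N₁ N₂ N≤j))
    (q i j (ℕ.m⊔n≤o⇒n≤o N₁ N₂ N≤i) (ℕ.m⊔n≤o⇒n≤o N₁ N₂ N≤j))

_+ℝ_ : ℝ → ℝ → ℝ
x +ℝ y = mkℝ (λ i → seq x i ℚ.+ seq y i) (+-cauchy {seq x} {seq y} (cauchy x) (cauchy y))

sumℝ : List ℝ → ℝ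
sumℝ = List.foldr _+ℝ_ 0ℝ

ℕ∞ : Set
ℕ∞ = ℕ ⁺

open AddSup≤ ℕ._≤_ public using (_≤⁺_)
open AddSup< ℕ._<_ public using (_<⁺_)

infixl 6 _+∞_

_+∞_ : ℕ∞ → ℕ∞ → ℕ∞
[ a ] +∞ [ b ] = [ a ℕ.+ b ]
[ _ ] +∞ ⊤⁺    = ⊤⁺
⊤⁺    +∞ _     = ⊤⁺

pred∞ : ℕ∞ → ℕ∞
pred∞ [ a ] = [ ℕ.pred a ]
pred∞ ⊤⁺    = ⊤⁺

sum∞ : List ℕ∞ → ℕ∞
sum∞ = List.foldr _+∞_ [ 0 ]

-- s is the sum of the (possibly infinite) family f: the least upper bound of
-- its sums over finite sets of indices.
IsSum : {A : Set} → (A → ℕ∞) → ℕ∞ → Set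
IsSum {A} f s = IsUpperBound s × (∀ t → IsUpperBound t → s ≤⁺ t)
  where
  IsUpperBound : ℕ∞ → Set
  IsUpperBound t = ∀ (as : List A) → Unique as → sum∞ (List.map f as) ≤⁺ t

-- The set { a | P a } is finite, and as lists each element exactly once.
Enumerates : {A : Set} → List A → (A → Set) → Set
Enumerates as P = Unique as × (∀ a → a ∈ as ⇔ P a)

-- A directed graph with finite out-degrees; the edge (v , i) leads from v to
-- its i-th child.
record RootedDigraph : Set₁ where
  field
    V     : Set
    root  : V
    br    : V → ℕ
    child : (v : V) → Fin (br v) → V

  E : Set
  E = Σ V (Fin ∘ br)

  source target : E → V
  source (v , i) = v
  target (v , i) = child v i

  data PathTo : V → Set where
    trivial : PathTo root
    extend  : (e : E) → PathTo (source e) → PathTo (target e)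

-- Being a tree with edges oriented away from the root is expressed by unique
-- existence of oriented paths from the root to each vertex; in particular the
-- child v i are pairwise distinct, so br v is the number of children of v.
record LocallyFiniteRootedTree : Set₁ where
  field
    digraph : RootedDigraph
  open RootedDigraph digraph public
  field
    path        : ∀ v → PathTo v
    path-unique : ∀ {v} (p q : PathTo v) → p ≡ q

  _∈ᵖ_ : ∀ {v} → E → PathTo v → Set
  e ∈ᵖ trivial    = ⊥
  e ∈ᵖ extend d p = e ≡ d ⊎ e ∈ᵖ p

  Incident : V → E → Set
  Incident v e = source e ≡ v ⊎ target e ≡ v

  HasValenceOne : V → Set
  HasValenceOne v = ∃! _≡_ (Incident v)

  IsLeaf : V → Set
  IsLeaf v = (v ≢ root × HasValenceOne v) ⊎ (v ≡ root × (∀ w → w ≡ root))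

  -- Refinement types, so that elements are equal as soon as the underlying
  -- vertices are.
  Leaf : Set
  Leaf = [ v ∈ V ∣ IsLeaf v ]

  Branching : Set
  Branching = [ v ∈ V ∣ 2 ℕ.≤ br v ]

  -- ∂T
  record Ray : Set where
    field
      edge  : ℕ → E
      start : source (edge 0) ≡ root
      next  : ∀ n → source (edge (suc n)) ≡ target (edge n)
  open Ray public

  data ∂̃ : Set where
    ray    : Ray → ∂̃
    toLeaf : (v : Leaf) → PathTo (value v) → ∂̃

  _onPath_ : E → ∂̃ → Set
  e onPath ray ρ      = ∃ λ n → edge ρ n ≡ e
  e onPath toLeaf v p = e ∈ᵖ p

  -- Equality of rays is taken edge by edge, as functions are not extensional.
  IsRay : Ray → ∂̃ → Set
  IsRay ρ (ray τ)      = ∀ n → edge ρ n ≡ edge τ n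
  IsRay ρ (toLeaf _ _) = ⊥

  EndsAt : Leaf → ∂̃ → Set
  EndsAt v (ray _)      = ⊥
  EndsAt v (toLeaf w _) = v ≡ w

record LengthFunction (T : LocallyFiniteRootedTree) : Set where
  open LocallyFiniteRootedTree T
  field
    length   : E → ℝ
    positive : ∀ e → 0ℝ <ℝ length e

record CapacityFunction (T : LocallyFiniteRootedTree) : Set where
  open LocallyFiniteRootedTree T
  field
    capacity : Leaf → ℕ∞
    positive : ∀ v → [ 1 ] ≤⁺ capacity v

module _ (T : LocallyFiniteRootedTree) (χ : CapacityFunction T) where
  open LocallyFiniteRootedTree T
  open CapacityFunction χ

  -- N = 1 + Σ_{v branching} (br v - 1) + Σ_{v leaf} (χ v - 1)
  IsN : ℕ∞ → Set
  IsN N = ∃₂ λ b c →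
    IsSum {Branching} (λ v → [ br (value v) ℕ.∸ 1 ]) b ×
    IsSum {Leaf} (λ v → pred∞ (capacity v)) c ×
    N ≡ [ 1 ] +∞ b +∞ c

  -- ρ may be chosen after the paths ρs have been chosen; is lists the steps at
  -- which the path to the leaf v was chosen.
  Admissible : ∀ {n} → Vec ∂̃ n → ∂̃ → Set
  Admissible {n} ρs (ray ρ)      = ¬ Any (IsRay ρ) ρs
  Admissible {n} ρs (toLeaf v _) = ∃ λ (is : List (Fin n)) →
    Enumerates is (λ i → EndsAt v (lookup ρs i)) × [ List.length is ] <⁺ capacity v

module _ (T : LocallyFiniteRootedTree) (ℓ : LengthFunction T) where
  open LocallyFiniteRootedTree T
  open LengthFunction ℓ

  -- x = ⟨ρ,τ⟩.  A relation, because ⟨ρ,τ⟩ is undefined for equal rays.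
  IsPairing : ∂̃ → ∂̃ → ℝ → Set
  IsPairing ρ τ x = ∃ λ (es : List E) →
    Enumerates es (λ e → e onPath ρ × e onPath τ) × x ≈ℝ sumℝ (List.map length es)

  -- x = Σ_j ⟨ρ,ρ_j⟩
  IsCost : ∀ {n} → ∂̃ → Vec ∂̃ n → ℝ → Set
  IsCost {n} ρ ρs x = ∃ λ (xs : Vec ℝ n) →
    Pointwise (IsPairing ρ) ρs xs × x ≈ℝ sumℝ (Vec.toList xs)

module _ (T : LocallyFiniteRootedTree) (ℓ : LengthFunction T) (χ : CapacityFunction T) where
  open LocallyFiniteRootedTree T

  IsMinimizer : ∀ {n} → Vec ∂̃ n → ∂̃ → Set
  IsMinimizer ρs ρ = Admissible T χ ρs ρ × ∃ λ x → IsCost T ℓ ρ ρs x ×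
    (∀ τ y → Admissible T χ ρs τ → IsCost T ℓ τ ρs y → x ≤ℝ y)

  -- Most recent choice first: the vector is ρ_{n-1} ∷ … ∷ ρ_0 ∷ [].
  Greedy : ∀ {n} → Vec ∂̃ n → Set
  Greedy []                 = ⊤
  Greedy (ρ₀ ∷ [])          = ⊤
  Greedy (ρ ∷ ρs@(_ ∷ _))   = IsMinimizer ρs ρ × Greedy ρs

  -- x is the value of n! obtained from some sequence of choices.
  IsFactorial : ℕ → ℝ → Set
  IsFactorial n x = ∃₂ λ ρ (ρs : Vec ∂̃ n) → Greedy (ρ ∷ ρs) × IsCost T ℓ ρ ρs x

-- Split each leaf of capacity c into c copies. Setting ⟨x,x⟩ = ∞ for a ray or a
-- copy of a leaf turns the pairing into an ultrametric proximity in which every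
-- path can be chosen at most once. Let w₀, …, wₙ be a greedy sequence and
-- t₁, …, tₙ arbitrary. Matching each t with its nearest unmatched w leaves over
-- some w with Σᵢ ⟨w,tᵢ⟩ ≤ Σ_{wⱼ ≠ w} ⟨w,wⱼ⟩, and by greediness the right-hand
-- side is at most the value n! attained by w = wₙ. When t₁, …, tₙ consists of
-- greedy sequences of lengths n − m and m, minimality gives
-- Σᵢ ⟨w,tᵢ⟩ ≥ (n − m)! + m!.

module Submission where

open import Defs
open import Axiom.ExcludedMiddle using (ExcludedMiddle)
open import Data.Nat using (ℕ; _≤_; _∸_)
open import Level using (0ℓ)
open import Relation.Nullary.Construct.Add.Supremum using ([_])

open import Data.Bool using (true; false)
open import Data.Empty using (⊥)
open import Data.Fin as Fin using (Fin)
open import Data.List as List using (List; []; _∷_; _++_)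
open import Data.List.Membership.Propositional using (_∈_)
import Data.List.Membership.Propositional.Properties as ∈
open import Data.List.Relation.Binary.Permutation.Propositional
  using (_↭_; refl; prep; swap; trans; ↭-sym)
import Data.List.Relation.Binary.Permutation.Propositional.Properties as ↭
open import Data.List.Relation.Binary.Subset.Propositional using (_⊆_)
import Data.List.Properties as List
open import Data.List.Relation.Unary.All as All using (All; []; _∷_)
open import Data.List.Relation.Unary.Any using (here; there)
open import Data.List.Relation.Unary.Unique.Propositional using (Unique)
open import Data.List.Relation.Unary.AllPairs using ([]; _∷_)
import Data.List.Relation.Unary.Unique.DecPropositional.Properties as UniqueDec
import Data.List.Relation.Unary.Unique.Propositional.Properties as Unique
import Data.Nat as ℕ
import Data.Nat.Properties as ℕ
open import Data.Product using (∃; ∃₂; _×_; _,_; proj₁; proj₂)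
open import Data.Rational as ℚ using (ℚ; 0ℚ)
import Data.Rational.Properties as ℚ
open import Data.Rational.Solver using (module +-*-Solver)
open import Data.Sum as Sum using (_⊎_; inj₁; inj₂)
open import Data.Unit using (⊤; tt)
open import Data.Vec as Vec using (Vec; []; _∷_)
import Data.Vec.Properties as Vec
open import Data.Vec.Relation.Binary.Pointwise.Inductive using (Pointwise; []; _∷_)
import Data.Vec.Relation.Unary.Any as VecAny
open import Function using (_∘_; id; flip; Equivalence; mk⇔)
import Relation.Binary.Construct.Add.Supremum.NonStrict as AddSup≤
import Relation.Binary.Construct.Add.Supremum.Strict as AddSup<
open import Relation.Binary.PropositionalEquality as ≡ using (_≡_; _≢_; refl; sym; cong; subst)
open import Relation.Nullary using (¬_; Dec; yes; no; does; contradiction)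
open import Relation.Nullary.Construct.Add.Supremum using (_⁺; ⊤⁺)
open import Relation.Nullary.Decidable using (decidable-stable)
open import Relation.Unary using (Decidable)

-- Permutations and enumerations of lists.

module _ {A : Set} where

  ∈⇒↭-∷ : ∀ {x : A} {xs} → x ∈ xs → ∃ λ ys → xs ↭ x ∷ ys
  ∈⇒↭-∷ {x} x∈xs with ys , zs , refl ← ∈.∈-∃++ x∈xs = ys ++ zs , ↭.shift x ys zs

  -- Case split for an element singled out of a greedy sequence: it is the last choice, or an
  -- earlier one, and then `zs` is what remains after removing both.
  ∷-↭-∷⁻ : ∀ {x y : A} {xs ys} → x ∷ xs ↭ y ∷ ys →
           (x ≡ y × xs ↭ ys) ⊎ ∃ λ zs → ys ↭ x ∷ zs × xs ↭ y ∷ zs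
  ∷-↭-∷⁻ {x} {y} p with ↭.∈-resp-↭ p (here refl)
  ... | here refl  = inj₁ (refl , ↭.drop-∷ p)
  ... | there x∈ys with zs , q ← ∈⇒↭-∷ x∈ys =
    inj₂ (zs , q , ↭.drop-∷ (trans p (trans (prep y q) (swap y x refl))))

  -- The elements of `xs` are removed from `ys` one at a time: as `x` does not recur in `xs`, the
  -- rest of `xs` still lies in what remains.
  Unique-⊆⇒↭-++ : ∀ {xs ys : List A} → Unique xs → xs ⊆ ys → ∃ λ zs → ys ↭ xs ++ zs
  Unique-⊆⇒↭-++ {[]}     {ys} _         _     = ys , refl
  Unique-⊆⇒↭-++ {x ∷ xs} {ys} (x∉ ∷ un) xs⊆ys =
    let rs , ys↭ = ∈⇒↭-∷ (xs⊆ys (here refl))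
        zs , rs↭ = Unique-⊆⇒↭-++ un (xs⊆rs ys↭)
    in zs , trans ys↭ (prep x rs↭)
    where
    xs⊆rs : ∀ {rs} → ys ↭ x ∷ rs → xs ⊆ rs
    xs⊆rs ys↭ z∈xs with ↭.∈-resp-↭ ys↭ (xs⊆ys (there z∈xs))
    ... | here z≡x   = contradiction (sym z≡x) (All.lookup x∉ z∈xs)
    ... | there z∈rs = z∈rs

  Enumerates⇒length≡ : ∀ {P : A → Set} {xs ys} → Enumerates xs P → Enumerates ys P →
                       List.length xs ≡ List.length ys
  Enumerates⇒length≡ (ux , ex) (uy , ey) = ℕ.≤-antisym
    (length≤ ux λ {a} → Equivalence.from (ey a) ∘ Equivalence.to (ex a))
    (length≤ uy λ {a} → Equivalence.from (ex a) ∘ Equivalence.to (ey a))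
    where
    length≤ : ∀ {xs ys : List A} → Unique xs → xs ⊆ ys → List.length xs ℕ.≤ List.length ys
    length≤ {xs} {ys} un xs⊆ys with zs , p ← Unique-⊆⇒↭-++ un xs⊆ys = begin
      List.length xs                     ≤⟨ ℕ.m≤m+n (List.length xs) (List.length zs) ⟩
      List.length xs ℕ.+ List.length zs  ≡⟨ List.length-++ xs ⟨
      List.length (xs ++ zs)             ≡⟨ ↭.↭-length p ⟨
      List.length ys                     ∎
      where open ℕ.≤-Reasoning

-- Finite sums in preordered commutative monoids.

-- The monoid laws only hold up to the preorder.
record OrderedMonoid : Set₁ where
  infix 4 _≼_
  infixl 6 _+_
  field
    Carrier      : Set
    _≼_          : Carrier → Carrier → Set
    _+_          : Carrier → Carrier → Carrier
    0#           : Carrier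
    ≼-refl       : ∀ {x} → x ≼ x
    ≼-trans      : ∀ {x y z} → x ≼ y → y ≼ z → x ≼ z
    +-mono       : ∀ {x y u v} → x ≼ y → u ≼ v → x + u ≼ y + v
    +-comm       : ∀ x y → x + y ≼ y + x
    +-assoc      : ∀ x y z → (x + y) + z ≼ x + (y + z)
    +-identityˡ  : ∀ x → 0# + x ≼ x
    +-identityˡ⁻ : ∀ x → x ≼ 0# + x

  +-exchange : ∀ x y z → x + (y + z) ≼ y + (x + z)
  +-exchange x y z =
    ≼-trans (+-comm x (y + z)) (≼-trans (+-assoc y z x) (+-mono ≼-refl (+-comm z x)))

  sum : List Carrier → Carrier
  sum = List.foldr _+_ 0#

  sum-↭ : ∀ {A : Set} (f : A → Carrier) {xs ys} → xs ↭ ys →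
          sum (List.map f xs) ≼ sum (List.map f ys)
  sum-↭ f refl         = ≼-refl
  sum-↭ f (prep x p)   = +-mono ≼-refl (sum-↭ f p)
  sum-↭ f (swap x y p) =
    ≼-trans (+-exchange (f x) (f y) _) (+-mono ≼-refl (+-mono ≼-refl (sum-↭ f p)))
  sum-↭ f (trans p q)  = ≼-trans (sum-↭ f p) (sum-↭ f q)

  sum-++ : ∀ {A : Set} (f : A → Carrier) xs ys →
           sum (List.map f xs) + sum (List.map f ys) ≼ sum (List.map f (xs ++ ys))
  sum-++ f []       ys = +-identityˡ _
  sum-++ f (x ∷ xs) ys = ≼-trans (+-assoc (f x) _ _) (+-mono ≼-refl (sum-++ f xs ys))

  -- The part of `ys` outside `xs` adds nonnegative terms. This turns inclusion of edge sets into
  -- comparison of lengths.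
  sum-⊆ : ∀ {A : Set} (f : A → Carrier) → (∀ x → 0# ≼ f x) → ∀ {xs ys} → Unique xs → xs ⊆ ys →
          sum (List.map f xs) ≼ sum (List.map f ys)
  sum-⊆ f 0≼f {xs} {ys} un xs⊆ys with zs , p ← Unique-⊆⇒↭-++ un xs⊆ys =
    ≼-trans (sum-prefix xs) (sum-↭ f (↭-sym p))
    where
    0≼sum : ∀ zs → 0# ≼ sum (List.map f zs)
    0≼sum []       = ≼-refl
    0≼sum (z ∷ zs) = ≼-trans (+-identityˡ⁻ 0#) (+-mono (0≼f z) (0≼sum zs))
    sum-prefix : ∀ xs → sum (List.map f xs) ≼ sum (List.map f (xs ++ zs))
    sum-prefix []       = 0≼sum zs
    sum-prefix (x ∷ xs) = +-mono ≼-refl (sum-prefix xs)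

-- Greedy sequences for an ultrametric proximity.

module _ (M : OrderedMonoid) where
  open OrderedMonoid M

  -- d measures proximity: it is large for close elements.
  module Ultrametric {X : Set} (d : X → X → Carrier)
    (d-sym   : ∀ x y → d x y ≼ d y x)
    (d-ultra : ∀ x y z → d x y ≼ d x z ⊎ d y z ≼ d x z)
    (d-total : ∀ x y z → d x z ≼ d y z ⊎ d y z ≼ d x z) where

    cost : X → List X → Carrier
    cost x ys = sum (List.map (d x) ys)

    -- The most recent choice comes first. The minimum runs over all of `X`; in the application a
    -- repeated copy has infinite cost.
    GreedyOrder : List X → Set
    GreedyOrder []       = ⊤
    GreedyOrder (x ∷ xs) = (∀ y → cost x xs ≼ cost y xs) × GreedyOrder xs

    nearest : ∀ t x xs → ∃₂ λ y ys → y ∷ ys ↭ x ∷ xs × All (λ z → d z t ≼ d y t) ys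
    nearest t x []       = x , [] , refl , []
    nearest t x (z ∷ xs) with nearest t z xs
    ... | y , ys , p , nearer with d-total x y t
    ...   | inj₁ x≼y = y , x ∷ ys , trans (swap y x refl) (prep x p) , x≼y ∷ nearer
    ...   | inj₂ y≼x = x , y ∷ ys , prep x p , y≼x ∷ All.map (flip ≼-trans y≼x) nearer

    -- Let `b` be the element matched with `t`. The survivor `y` was still available then, so
    -- `d y t` is at most `d b t`, and the ultrametric inequality gives `d y t ≼ d y b`. Summing
    -- over all `t` compares the two costs.
    leftover : ∀ xs ts → List.length xs ≡ ℕ.suc (List.length ts) →
               ∃₂ λ x ys → x ∷ ys ↭ xs × cost x ts ≼ cost x ys
    leftover (x ∷ [])  []       _  = x , [] , refl , ≼-refl
    leftover (x ∷ xs)  (t ∷ ts) eq with nearest t x xs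
    ... | b , bs , p , nearer with leftover bs ts (ℕ.suc-injective (≡.trans (↭.↭-length p) eq))
    ...   | y , ys , q , le =
      y , b ∷ ys , trans (swap y b refl) (trans (prep b q) p) , +-mono y-t≼y-b le
      where
      y-t≼b-t = All.lookup nearer (↭.∈-resp-↭ q (here refl))
      y-t≼y-b : d y t ≼ d y b
      y-t≼y-b with d-ultra y t b
      ... | inj₁ le = le
      ... | inj₂ le = ≼-trans y-t≼b-t (≼-trans (d-sym b t) le)

    -- Every choice, not only the last, is optimal against all the others. By induction: if `y` is
    -- an earlier choice than `w`, the ultrametric inequality for `x`, `y`, `w` decides whether the
    -- minimality of `y` (induction) suffices or that of `w` is used as well.
    greedy-exchange : ∀ {xs} → GreedyOrder xs → ∀ {y ys} → y ∷ ys ↭ xs → ∀ x → cost y ys ≼ cost x ys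
    greedy-exchange {[]} _ p x = contradiction (↭.↭-length p) λ ()
    greedy-exchange {w ∷ ws} (min , greedy) {y} p x with ∷-↭-∷⁻ p
    ... | inj₁ (refl , q) = ≼-trans (sum-↭ (d w) q) (≼-trans (min x) (sum-↭ (d x) (↭-sym q)))
    ... | inj₂ (zs , q , r) =
      ≼-trans (sum-↭ (d y) r) (≼-trans main (sum-↭ (d x) (↭-sym r)))
      where
      ih = greedy-exchange greedy (↭-sym q)
      main : d y w + cost y zs ≼ d x w + cost x zs
      main with d-ultra x y w
      ... | inj₂ yw≼xw = +-mono yw≼xw (ih x)
      -- Pass from `y` to `w` by induction, from `w` to `x` by minimality of `w` against `y ∷ zs`,
      -- and finally replace `d x y` by `d x w`.
      ... | inj₁ xy≼xw =
        ≼-trans (+-mono (d-sym y w) (ih w)) (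
        ≼-trans (sum-↭ (d w) (↭-sym q)) (
        ≼-trans (min x) (
        ≼-trans (sum-↭ (d x) q)
        (+-mono xy≼xw ≼-refl))))

    -- For an earlier `y`, exchange within `ws` gives `cost y zs ≼ cost w zs`, and the proximity of
    -- `y` and `w` occurs in both sums.
    greedy-last-max : ∀ {w ws} → GreedyOrder (w ∷ ws) → ∀ {y ys} → y ∷ ys ↭ w ∷ ws →
                      cost y ys ≼ cost w ws
    greedy-last-max {w} {ws} (_ , greedy) {y} p with ∷-↭-∷⁻ p
    ... | inj₁ (refl , q)   = sum-↭ (d w) q
    ... | inj₂ (zs , q , r) =
      ≼-trans (sum-↭ (d y) r) (
      ≼-trans (+-mono (d-sym y w) (greedy-exchange greedy (↭-sym q) w))
      (sum-↭ (d w) (↭-sym q)))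

    greedy-superadditive : ∀ {w ws u us v vs} →
      GreedyOrder (w ∷ ws) → GreedyOrder (u ∷ us) → GreedyOrder (v ∷ vs) →
      List.length ws ≡ List.length us ℕ.+ List.length vs →
      cost u us + cost v vs ≼ cost w ws
    greedy-superadditive {w} {ws} {us = us} {vs = vs} gw (minᵤ , _) (minᵥ , _) eq
      -- The last choices `u` and `v` are dropped, so there is exactly one target fewer than
      -- elements of `w ∷ ws`.
      with leftover (w ∷ ws) (us ++ vs) (cong ℕ.suc (≡.trans eq (sym (List.length-++ us))))
    ... | x , xs , p , le =
      ≼-trans (+-mono (minᵤ x) (minᵥ x)) (
      ≼-trans (sum-++ (d x) us vs) (
      ≼-trans le
      (greedy-last-max gw p)))

-- Approximating sequences of reals as an ordered monoid.

-- The order of ℝ only involves the approximating sequences, and conversion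
-- checking on the Cauchy proofs is intractably slow.
Approx : Set
Approx = ℕ → ℚ

infix 4 _≤ᵃ_
infixl 6 _+ᵃ_

_+ᵃ_ : Approx → Approx → Approx
(x +ᵃ y) i = x i ℚ.+ y i

-- A record, so that `x` and `y` can be inferred from the type.
record _≤ᵃ_ (x y : Approx) : Set where
  constructor approx-≤
  field eventually-≤ : ∀ ε → 0ℚ ℚ.< ε → ∃ λ N → ∀ i → N ℕ.≤ i → x i ℚ.≤ y i ℚ.+ ε

pointwise-≤ : ∀ {x y} → (∀ i → x i ℚ.≤ y i) → x ≤ᵃ y
pointwise-≤ {x} {y} x≤y = approx-≤ λ ε ε>0 → 0 , λ i _ → begin
  x i          ≤⟨ x≤y i ⟩
  y i          ≡⟨ ℚ.+-identityʳ (y i) ⟨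
  y i ℚ.+ 0ℚ   ≤⟨ ℚ.+-monoʳ-≤ (y i) (ℚ.<⇒≤ ε>0) ⟩
  y i ℚ.+ ε    ∎
  where open ℚ.≤-Reasoning

pointwise-≡ : ∀ {x y} → (∀ i → x i ≡ y i) → x ≤ᵃ y
pointwise-≡ x≡y = pointwise-≤ (ℚ.≤-reflexive ∘ x≡y)

≤ᵃ-trans : ∀ {x y z} → x ≤ᵃ y → y ≤ᵃ z → x ≤ᵃ z
≤ᵃ-trans {x} {y} {z} (approx-≤ x≤y) (approx-≤ y≤z) = approx-≤ x≤z
  where
  open ℚ.≤-Reasoning
  x≤z : ∀ ε → 0ℚ ℚ.< ε → ∃ λ N → ∀ i → N ℕ.≤ i → x i ℚ.≤ z i ℚ.+ ε
  x≤z ε ε>0 with halve ε ε>0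
  ... | δ , δ>0 , refl with x≤y δ δ>0 | y≤z δ δ>0
  ... | M , p | N , q = M ℕ.⊔ N , λ i h → begin
    x i                   ≤⟨ p i (ℕ.m⊔n≤o⇒m≤o M N h) ⟩
    y i ℚ.+ δ             ≤⟨ ℚ.+-monoˡ-≤ δ (q i (ℕ.m⊔n≤o⇒n≤o M N h)) ⟩
    (z i ℚ.+ δ) ℚ.+ δ     ≡⟨ ℚ.+-assoc (z i) δ δ ⟩
    z i ℚ.+ (δ ℚ.+ δ)     ∎

+ᵃ-mono-≤ : ∀ {x y u v} → x ≤ᵃ y → u ≤ᵃ v → x +ᵃ u ≤ᵃ y +ᵃ v
+ᵃ-mono-≤ {x} {y} {u} {v} (approx-≤ x≤y) (approx-≤ u≤v) = approx-≤ x+u≤y+v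
  where
  open ℚ.≤-Reasoning
  open +-*-Solver
  regroup : ∀ a b c → (a ℚ.+ c) ℚ.+ (b ℚ.+ c) ≡ (a ℚ.+ b) ℚ.+ (c ℚ.+ c)
  regroup = solve 3 (λ a b c → (a :+ c) :+ (b :+ c) := (a :+ b) :+ (c :+ c)) refl
  x+u≤y+v : ∀ ε → 0ℚ ℚ.< ε → ∃ λ N → ∀ i → N ℕ.≤ i → x i ℚ.+ u i ℚ.≤ (y i ℚ.+ v i) ℚ.+ ε
  x+u≤y+v ε ε>0 with halve ε ε>0
  ... | δ , δ>0 , refl with x≤y δ δ>0 | u≤v δ δ>0
  ... | M , p | N , q = M ℕ.⊔ N , λ i h → begin
    x i ℚ.+ u i                        ≤⟨ ℚ.+-mono-≤ (p i (ℕ.m⊔n≤o⇒m≤o M N h)) (q i (ℕ.m⊔n≤o⇒n≤o M N h)) ⟩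
    (y i ℚ.+ δ) ℚ.+ (v i ℚ.+ δ)        ≡⟨ regroup (y i) (v i) δ ⟩
    (y i ℚ.+ v i) ℚ.+ (δ ℚ.+ δ)        ∎

<ℝ⇒≤ᵃ : ∀ {x y} → x <ℝ y → seq x ≤ᵃ seq y
<ℝ⇒≤ᵃ {x} {y} (δ , δ>0 , N , x+δ≤y) = approx-≤ λ ε ε>0 → N , λ i N≤i → begin
  seq x i          ≡⟨ ℚ.+-identityʳ (seq x i) ⟨
  seq x i ℚ.+ 0ℚ   ≤⟨ ℚ.+-monoʳ-≤ (seq x i) (ℚ.<⇒≤ δ>0) ⟩
  seq x i ℚ.+ δ    ≤⟨ x+δ≤y i N≤i ⟩
  seq y i          ≡⟨ ℚ.+-identityʳ (seq y i) ⟨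
  seq y i ℚ.+ 0ℚ   ≤⟨ ℚ.+-monoʳ-≤ (seq y i) (ℚ.<⇒≤ ε>0) ⟩
  seq y i ℚ.+ ε    ∎
  where open ℚ.≤-Reasoning

approxMonoid : OrderedMonoid
approxMonoid = record
  { Carrier      = Approx
  ; _≼_          = _≤ᵃ_
  ; _+_          = _+ᵃ_
  ; 0#           = seq 0ℝ
  ; ≼-refl       = pointwise-≡ λ _ → refl
  ; ≼-trans      = ≤ᵃ-trans
  ; +-mono       = +ᵃ-mono-≤
  ; +-comm       = λ x y → pointwise-≡ λ i → ℚ.+-comm (x i) (y i)
  ; +-assoc      = λ x y z → pointwise-≡ λ i → ℚ.+-assoc (x i) (y i) (z i)
  ; +-identityˡ  = λ x → pointwise-≡ λ i → ℚ.+-identityˡ (x i)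
  ; +-identityˡ⁻ = λ x → pointwise-≡ λ i → sym (ℚ.+-identityˡ (x i))
  }

seq-sumℝ : {A : Set} (f : A → ℝ) (xs : List A) →
           seq (sumℝ (List.map f xs)) ≡ OrderedMonoid.sum approxMonoid (List.map (seq ∘ f) xs)
seq-sumℝ f []       = refl
seq-sumℝ f (x ∷ xs) = cong (seq (f x) +ᵃ_) (seq-sumℝ f xs)

-- Adjoining an absorbing largest element to an ordered monoid.

module _ (M : OrderedMonoid) where
  open OrderedMonoid M
  open AddSup≤ _≼_ renaming (_≤⁺_ to _≼⁺_)

  infixl 6 _+⁺_

  _+⁺_ : Carrier ⁺ → Carrier ⁺ → Carrier ⁺
  [ x ] +⁺ [ y ] = [ x + y ]
  [ _ ] +⁺ ⊤⁺    = ⊤⁺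
  ⊤⁺    +⁺ _     = ⊤⁺

  private
    +⁺-mono : ∀ {x y u v} → x ≼⁺ y → u ≼⁺ v → x +⁺ u ≼⁺ y +⁺ v
    +⁺-mono [ p ]    [ q ]    = [ +-mono p q ]
    +⁺-mono [ _ ]    (_ ≤⊤⁺)  = _ ≤⊤⁺
    +⁺-mono (_ ≤⊤⁺)  _        = _ ≤⊤⁺

    +⁺-comm : ∀ x y → x +⁺ y ≼⁺ y +⁺ x
    +⁺-comm [ x ] [ y ] = [ +-comm x y ]
    +⁺-comm [ _ ] ⊤⁺    = _ ≤⊤⁺
    +⁺-comm ⊤⁺    [ _ ] = _ ≤⊤⁺
    +⁺-comm ⊤⁺    ⊤⁺    = _ ≤⊤⁺

    +⁺-assoc : ∀ x y z → (x +⁺ y) +⁺ z ≼⁺ x +⁺ (y +⁺ z)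
    +⁺-assoc [ x ] [ y ] [ z ] = [ +-assoc x y z ]
    +⁺-assoc [ _ ] [ _ ] ⊤⁺    = _ ≤⊤⁺
    +⁺-assoc [ _ ] ⊤⁺    _     = _ ≤⊤⁺
    +⁺-assoc ⊤⁺    _     _     = _ ≤⊤⁺

    +⁺-identityˡ : ∀ x → [ 0# ] +⁺ x ≼⁺ x
    +⁺-identityˡ [ x ] = [ +-identityˡ x ]
    +⁺-identityˡ ⊤⁺    = _ ≤⊤⁺

    +⁺-identityˡ⁻ : ∀ x → x ≼⁺ [ 0# ] +⁺ x
    +⁺-identityˡ⁻ [ x ] = [ +-identityˡ⁻ x ]
    +⁺-identityˡ⁻ ⊤⁺    = _ ≤⊤⁺

    ≼⁺-refl : ∀ {x} → x ≼⁺ x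
    ≼⁺-refl {[ _ ]} = [ ≼-refl ]
    ≼⁺-refl {⊤⁺}    = _ ≤⊤⁺

  addTop : OrderedMonoid
  addTop = record
    { Carrier      = Carrier ⁺
    ; _≼_          = _≼⁺_
    ; _+_          = _+⁺_
    ; 0#           = [ 0# ]
    ; ≼-refl       = ≼⁺-refl
    ; ≼-trans      = ≤⁺-trans ≼-trans
    ; +-mono       = +⁺-mono
    ; +-comm       = +⁺-comm
    ; +-assoc      = +⁺-assoc
    ; +-identityˡ  = +⁺-identityˡ
    ; +-identityˡ⁻ = +⁺-identityˡ⁻
    }

-- Paths in the tree and their common edges.

module PathGeometry (em : ExcludedMiddle 0ℓ) (T : LocallyFiniteRootedTree) where
  open LocallyFiniteRootedTree T

  infix 4 _≺_

  _≺_ : E → V → Set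
  e ≺ v = e ∈ᵖ path v

  ∈ᵖ-irrelevant : ∀ {v e} (p q : PathTo v) → e ∈ᵖ p → e ∈ᵖ q
  ∈ᵖ-irrelevant p q = subst (_ ∈ᵖ_) (path-unique p q)

  ≺-root : ∀ {e} → ¬ e ≺ root
  ≺-root = ∈ᵖ-irrelevant (path root) trivial

  ≺-target⁻ : ∀ {e} d → e ≺ target d → e ≡ d ⊎ e ≺ source d
  ≺-target⁻ d = ∈ᵖ-irrelevant (path _) (extend d (path (source d)))

  ≺-target⁺ : ∀ {e} d → e ≡ d ⊎ e ≺ source d → e ≺ target d
  ≺-target⁺ d = ∈ᵖ-irrelevant (extend d (path (source d))) (path _)

  pathLength : ∀ {v} → PathTo v → ℕ
  pathLength trivial      = 0
  pathLength (extend _ p) = ℕ.suc (pathLength p)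

  depth : V → ℕ
  depth v = pathLength (path v)

  depth-edge : ∀ ρ n → depth (source (edge ρ n)) ≡ n
  depth-edge ρ ℕ.zero    =
    ≡.trans (cong depth (start ρ)) (cong pathLength (path-unique (path root) trivial))
  depth-edge ρ (ℕ.suc n) = begin
    depth (source (edge ρ (ℕ.suc n)))  ≡⟨ cong depth (next ρ n) ⟩
    depth (target d)                   ≡⟨ cong pathLength (path-unique (path _) (extend d (path _))) ⟩
    ℕ.suc (depth (source d))           ≡⟨ cong ℕ.suc (depth-edge ρ n) ⟩
    ℕ.suc n                            ∎
    where
    open ≡.≡-Reasoning
    d = edge ρ n

  -- The position of an edge on any ray is the depth of its source, hence determined by the edge
  -- alone.
  edge-index : ∀ ρ τ {i j} → edge ρ i ≡ edge τ j → i ≡ j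
  edge-index ρ τ {i} {j} eq =
    ≡.trans (sym (depth-edge ρ i)) (≡.trans (cong (depth ∘ source) eq) (depth-edge τ j))

  edges : ∀ {v} → PathTo v → List E
  edges trivial      = []
  edges (extend e p) = e ∷ edges p

  ∈ᵖ⇒∈-edges : ∀ {v e} (p : PathTo v) → e ∈ᵖ p → e ∈ edges p
  ∈ᵖ⇒∈-edges (extend d p) (inj₁ e≡d) = here e≡d
  ∈ᵖ⇒∈-edges (extend d p) (inj₂ e∈p) = there (∈ᵖ⇒∈-edges p e∈p)

  ≺-edge⁻ : ∀ ρ n {e} → e ≺ source (edge ρ n) → ∃ λ k → edge ρ k ≡ e
  ≺-edge⁻ ρ ℕ.zero    {e} e≺ = contradiction (subst (e ≺_) (start ρ) e≺) ≺-root
  ≺-edge⁻ ρ (ℕ.suc n) {e} e≺ with ≺-target⁻ (edge ρ n) (subst (e ≺_) (next ρ n) e≺)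
  ... | inj₁ refl = n , refl
  ... | inj₂ e≺′  = ≺-edge⁻ ρ n e≺′

  ≺-edge⁺ : ∀ ρ {i j} → i ℕ.≤′ j → edge ρ i ≺ target (edge ρ j)
  ≺-edge⁺ ρ {i}             (ℕ.≤′-reflexive refl) = ≺-target⁺ (edge ρ i) (inj₁ refl)
  ≺-edge⁺ ρ {i} {ℕ.suc j} (ℕ.≤′-step i≤j)       =
    ≺-target⁺ (edge ρ (ℕ.suc j)) (inj₂ (subst (edge ρ i ≺_) (sym (next ρ j)) (≺-edge⁺ ρ i≤j)))

  -- Together with `onPath-linear`, this makes the edges of a path a chain closed under ancestors;
  -- `Common-total` follows from these two facts.
  onPath-closed : ∀ {e f} ρ → f onPath ρ → e ≺ target f → e onPath ρ
  onPath-closed (ray ρ) (n , refl) e≺ with ≺-target⁻ (edge ρ n) e≺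
  ... | inj₁ refl = n , refl
  ... | inj₂ e≺′  = ≺-edge⁻ ρ n e≺′
  onPath-closed {e} {f} (toLeaf _ p) = closed p
    where
    closed : ∀ {v} (p : PathTo v) → f ∈ᵖ p → e ≺ target f → e ∈ᵖ p
    closed (extend d p) (inj₁ refl) = ∈ᵖ-irrelevant (path _) (extend d p)
    closed (extend d p) (inj₂ f∈p)  = inj₂ ∘ closed p f∈p

  onPath-linear : ∀ {e f} ρ → e onPath ρ → f onPath ρ → e ≺ target f ⊎ f ≺ target e
  onPath-linear (ray ρ) (i , refl) (j , refl) =
    Sum.map (≺-edge⁺ ρ ∘ ℕ.≤⇒≤′) (≺-edge⁺ ρ ∘ ℕ.≤⇒≤′) (ℕ.≤-total i j)
  onPath-linear {e} {f} (toLeaf _ p) = linear p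
    where
    linear : ∀ {v} (p : PathTo v) → e ∈ᵖ p → f ∈ᵖ p → e ≺ target f ⊎ f ≺ target e
    linear (extend d p) (inj₁ refl) f∈          = inj₂ (∈ᵖ-irrelevant (extend d p) (path _) f∈)
    linear (extend d p) (inj₂ e∈p)  (inj₁ refl) = inj₁ (≺-target⁺ d (inj₂ (∈ᵖ-irrelevant p (path _) e∈p)))
    linear (extend d p) (inj₂ e∈p)  (inj₂ f∈p)  = linear p e∈p f∈p

  Common : ∂̃ → ∂̃ → E → Set
  Common ρ τ e = e onPath ρ × e onPath τ

  Common-swap : ∀ {ρ τ e} → Common ρ τ e → Common τ ρ e
  Common-swap (e∈ρ , e∈τ) = e∈τ , e∈ρ

  -- The edges that τ shares with ρ and those that it shares with σ are both
  -- initial segments of τ.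
  Common-total : ∀ ρ σ τ → (∀ {e} → Common ρ τ e → Common σ τ e) ⊎
                           (∀ {e} → Common σ τ e → Common ρ τ e)
  Common-total ρ σ τ with em {∃ λ e → Common ρ τ e × ¬ e onPath σ}
  ... | no ∄e = inj₁ λ {e} (e∈ρ , e∈τ) →
    decidable-stable em (λ e∉σ → ∄e (e , (e∈ρ , e∈τ) , e∉σ)) , e∈τ
  ... | yes (e , (e∈ρ , e∈τ) , e∉σ) = inj₂ λ (f∈σ , f∈τ) →
    below f∈σ (onPath-linear τ e∈τ f∈τ) , f∈τ
    where
    below : ∀ {f} → f onPath σ → e ≺ target f ⊎ f ≺ target e → f onPath ρ
    below f∈σ (inj₁ e≺f) = contradiction (onPath-closed σ f∈σ e≺f) e∉σ
    below f∈σ (inj₂ f≺e) = onPath-closed ρ e∈ρ f≺e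

  Same : ∂̃ → ∂̃ → Set
  Same (ray ρ)      τ = IsRay ρ τ
  Same (toLeaf v _) τ = EndsAt v τ

  Same-sym : ∀ ρ τ → Same ρ τ → Same τ ρ
  Same-sym (ray ρ)      (ray τ)      ρ≗τ n = sym (ρ≗τ n)
  Same-sym (toLeaf _ _) (toLeaf _ _) v≡w   = sym v≡w

  Same-trans : ∀ ρ σ τ → Same ρ σ → Same σ τ → Same ρ τ
  Same-trans (ray ρ)      (ray σ)      (ray τ)      ρ≗σ  σ≗τ n = ≡.trans (ρ≗σ n) (σ≗τ n)
  Same-trans (toLeaf _ _) (toLeaf _ _) (toLeaf _ _) u≡v  v≡w   = ≡.trans u≡v v≡w

  Same-onPath : ∀ ρ τ {e} → Same ρ τ → e onPath ρ → e onPath τ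
  Same-onPath (ray ρ)      (ray τ)      ρ≗τ  (n , ρₙ≡e) = n , ≡.trans (sym (ρ≗τ n)) ρₙ≡e
  Same-onPath (toLeaf _ p) (toLeaf _ q) refl e∈p        = ∈ᵖ-irrelevant p q e∈p

  -- The one case with infinitely many common edges. A path to a leaf is finite, so its pairing with
  -- itself is defined.
  SameRay : ∂̃ → ∂̃ → Set
  SameRay (ray ρ)      τ = IsRay ρ τ
  SameRay (toLeaf _ _) τ = ⊥

  -- A path to a leaf has finitely many edges. For two rays differing at position `n`, the edge
  -- `edge ρ n` is not on `τ`, since it could only occur there at position `n`; so every common edge
  -- comes before it.
  Common-bounded : ∀ ρ τ → ¬ SameRay ρ τ → ∃ λ es → ∀ {e} → Common ρ τ e → e ∈ es
  Common-bounded (toLeaf _ p) τ            _    = edges p , λ (e∈p , _) → ∈ᵖ⇒∈-edges p e∈p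
  Common-bounded (ray ρ)      (toLeaf _ q) _    = edges q , λ (_ , e∈q) → ∈ᵖ⇒∈-edges q e∈q
  Common-bounded (ray ρ)      (ray τ)      ρ≉τ with em {∃ λ n → edge ρ n ≢ edge τ n}
  ... | no ∄n = contradiction (λ n → decidable-stable em (λ ρₙ≢τₙ → ∄n (n , ρₙ≢τₙ))) ρ≉τ
  ... | yes (n , ρₙ≢τₙ) = edges (path (target (edge ρ n))) , λ (e∈ρ , e∈τ) →
    ∈ᵖ⇒∈-edges (path _) (above e∈τ (onPath-linear (ray ρ) e∈ρ (n , refl)))
    where
    ρₙ∉τ : ¬ edge ρ n onPath ray τ
    ρₙ∉τ (k , τₖ≡ρₙ) with edge-index τ ρ τₖ≡ρₙ
    ... | refl = ρₙ≢τₙ (sym τₖ≡ρₙ)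
    above : ∀ {e} → e onPath ray τ → e ≺ target (edge ρ n) ⊎ edge ρ n ≺ target e →
            e ≺ target (edge ρ n)
    above e∈τ (inj₁ e≺ρₙ) = e≺ρₙ
    above e∈τ (inj₂ ρₙ≺e) = contradiction (onPath-closed (ray τ) e∈τ ρₙ≺e) ρₙ∉τ

  Common-finite : ∀ ρ τ → ¬ SameRay ρ τ → ∃ λ es → Enumerates es (Common ρ τ)
  Common-finite ρ τ ρ≉τ with es , bound ← Common-bounded ρ τ ρ≉τ =
    List.filter common? (List.deduplicate _≟_ es)
    , Unique.filter⁺ common? (UniqueDec.deduplicate-! _≟_ es)
    , λ e → mk⇔ (proj₂ ∘ ∈.∈-filter⁻ common? {xs = List.deduplicate _≟_ es})
                (λ c → ∈.∈-filter⁺ common? (∈.∈-deduplicate⁺ _≟_ (bound c)) c)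
    where
    _≟_ : (e f : E) → Dec (e ≡ f)
    _ ≟ _ = em
    common? : Decidable (Common ρ τ)
    common? _ = em

-- Counting choices and comparing with capacities.

-- A general `f` lets the induction pass to `f ∘ Fin.suc`; the case used is `f = id`.
length-filter-tabulate : {A B : Set} {P : A → Set} {Q : B → Set} (P? : Decidable P) (Q? : Decidable Q) →
  ∀ {n} (xs : Vec A n) (f : Fin n → B) → (∀ i → does (Q? (f i)) ≡ does (P? (Vec.lookup xs i))) →
  List.length (List.filter Q? (List.tabulate f)) ≡ Vec.count P? xs
length-filter-tabulate P? Q? []       f eq = refl
length-filter-tabulate P? Q? (x ∷ xs) f eq
  with does (Q? (f Fin.zero)) | does (P? x) | eq Fin.zero | length-filter-tabulate P? Q? xs (f ∘ Fin.suc) (eq ∘ Fin.suc)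
... | true  | true  | _ | ih = cong ℕ.suc ih
... | false | false | _ | ih = ih

module _ where
  open AddSup≤ ℕ._≤_ using ([_])
  open AddSup< ℕ._<_ using ([_]; [_]<⊤⁺)

  1≤⇒0< : ∀ {k} → [ 1 ] ≤⁺ k → [ 0 ] <⁺ k
  1≤⇒0< {[ _ ]} [ 1≤k ] = [ 1≤k ]
  1≤⇒0< {⊤⁺}    _       = [ 0 ]<⊤⁺

  ≤-<⁺-trans : ∀ {i j k} → i ≤ j → [ j ] <⁺ k → [ i ] <⁺ k
  ≤-<⁺-trans i≤j [ j<k ]  = [ ℕ.≤-<-trans i≤j j<k ]
  ≤-<⁺-trans i≤j [ _ ]<⊤⁺ = [ _ ]<⊤⁺

-- Multiplicities of paths and admissibility.

module Copies (em : ExcludedMiddle 0ℓ) (T : LocallyFiniteRootedTree)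
              (ℓ : LengthFunction T) (χ : CapacityFunction T) where
  open LocallyFiniteRootedTree T
  open LengthFunction ℓ using (length)
  open CapacityFunction χ using (capacity)
  open PathGeometry em T

  open AddSup< ℕ._<_ using ([_]; [_]<⊤⁺)

  -- Capacity 1 for rays encodes that a ray is chosen at most once, so rays and leaves obey the same
  -- rule.
  cap : ∂̃ → ℕ∞
  cap (ray _)      = [ 1 ]
  cap (toLeaf v _) = capacity v

  0<cap : ∀ ρ → [ 0 ] <⁺ cap ρ
  0<cap (ray _)      = [ ℕ.s≤s ℕ.z≤n ]
  0<cap (toLeaf v _) = 1≤⇒0< (CapacityFunction.positive χ v)

  Same? : ∀ τ → Decidable (Same τ)
  Same? _ _ = em

  count : ∂̃ → ∀ {n} → Vec ∂̃ n → ℕ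
  count τ = Vec.count (Same? τ)

  count-∷-same : ∀ τ σ {n} (ρs : Vec ∂̃ n) → Same τ σ → count τ (σ ∷ ρs) ≡ ℕ.suc (count τ ρs)
  count-∷-same τ σ ρs s with em {Same τ σ}
  ... | yes _ = refl
  ... | no ¬s = contradiction s ¬s

  count-∷-other : ∀ τ σ {n} (ρs : Vec ∂̃ n) → ¬ Same τ σ → count τ (σ ∷ ρs) ≡ count τ ρs
  count-∷-other τ σ ρs ¬s with em {Same τ σ}
  ... | yes s = contradiction s ¬s
  ... | no _  = refl

  count-∷-≤ : ∀ τ σ {n} (ρs : Vec ∂̃ n) → count τ ρs ≤ count τ (σ ∷ ρs)
  count-∷-≤ τ σ ρs with em {Same τ σ}
  ... | yes _ = ℕ.n≤1+n _
  ... | no _  = ℕ.≤-refl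

  count-cong : ∀ τ σ {n} (ρs : Vec ∂̃ n) → Same τ σ → count τ ρs ≡ count σ ρs
  count-cong τ σ []       s = refl
  count-cong τ σ (ρ ∷ ρs) s with em {Same τ ρ} | em {Same σ ρ}
  ... | yes _  | yes _  = cong ℕ.suc (count-cong τ σ ρs s)
  ... | no _   | no _   = count-cong τ σ ρs s
  ... | yes τρ | no ¬σρ = contradiction (Same-trans σ τ ρ (Same-sym τ σ s) τρ) ¬σρ
  ... | no ¬τρ | yes σρ = contradiction (Same-trans τ σ ρ s σρ) ¬τρ

  count-zero : ∀ τ {n} (ρs : Vec ∂̃ n) → ¬ VecAny.Any (Same τ) ρs → count τ ρs ≡ 0
  count-zero τ []       _  = refl
  count-zero τ (σ ∷ ρs) ∄σ =
    ≡.trans (count-∷-other τ σ ρs (∄σ ∘ VecAny.here)) (count-zero τ ρs (∄σ ∘ VecAny.there))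

  count-positive : ∀ τ {n} (ρs : Vec ∂̃ n) → VecAny.Any (Same τ) ρs → 0 ℕ.< count τ ρs
  count-positive τ (σ ∷ ρs) (VecAny.here s)  =
    subst (0 ℕ.<_) (sym (count-∷-same τ σ ρs s)) (ℕ.s≤s ℕ.z≤n)
  count-positive τ (σ ∷ ρs) (VecAny.there a) = ℕ.<-≤-trans (count-positive τ ρs a) (count-∷-≤ τ σ ρs)

  occurrences : ∀ τ {n} (ρs : Vec ∂̃ n) → ∃ λ (is : List (Fin n)) →
                Enumerates is (Same τ ∘ Vec.lookup ρs) × List.length is ≡ count τ ρs
  occurrences τ {n} ρs =
    List.filter occurs? (List.allFin n)
    , (Unique.filter⁺ occurs? (Unique.allFin⁺ n)
      , λ i → mk⇔ (proj₂ ∘ ∈.∈-filter⁻ occurs? {xs = List.allFin n}) (∈.∈-filter⁺ occurs? (∈.∈-allFin i)))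
    , length-filter-tabulate (Same? τ) occurs? ρs id (λ _ → refl)
    where
    occurs? : Decidable (Same τ ∘ Vec.lookup ρs)
    occurs? i = Same? τ (Vec.lookup ρs i)

  -- A ray not chosen before has count 0. For a leaf, any two enumerations of the earlier choices
  -- have the same length.
  admissible⇒count<cap : ∀ {n} (ρs : Vec ∂̃ n) ρ → Admissible T χ ρs ρ → [ count ρ ρs ] <⁺ cap ρ
  admissible⇒count<cap ρs (ray ρ) ρ∉ρs =
    subst (λ k → [ k ] <⁺ [ 1 ]) (sym (count-zero (ray ρ) ρs ρ∉ρs)) (0<cap (ray ρ))
  admissible⇒count<cap ρs τ@(toLeaf v _) (_ , enum , lt) with occurrences τ ρs
  ... | _ , enum′ , eq =
    subst (λ k → [ k ] <⁺ capacity v) (≡.trans (Enumerates⇒length≡ enum enum′) eq) lt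

  count<cap⇒admissible : ∀ {n} (ρs : Vec ∂̃ n) ρ → [ count ρ ρs ] <⁺ cap ρ → Admissible T χ ρs ρ
  count<cap⇒admissible ρs (ray ρ) [ lt ] ρ∈ρs = ℕ.<⇒≱ (count-positive (ray ρ) ρs ρ∈ρs) (ℕ.≤-pred lt)
  count<cap⇒admissible ρs τ@(toLeaf v _) lt with occurrences τ ρs
  ... | is , enum , eq = is , enum , subst (λ k → [ k ] <⁺ capacity v) (sym eq) lt

  greedy⇒admissible : ∀ {n ρ} (ρs : Vec ∂̃ n) → Greedy T ℓ χ (ρ ∷ ρs) → Admissible T χ ρs ρ
  -- The first choice is arbitrary; it is admissible because capacities are positive.
  greedy⇒admissible {ρ = ρ} []      _               = count<cap⇒admissible [] ρ (0<cap ρ)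
  greedy⇒admissible         (_ ∷ _) ((adm , _) , _) = adm

  greedy-tail : ∀ {n ρ} (ρs : Vec ∂̃ n) → Greedy T ℓ χ (ρ ∷ ρs) → Greedy T ℓ χ ρs
  greedy-tail []      _       = tt
  greedy-tail (_ ∷ _) (_ , g) = g

  -- Copies of paths and their proximity.

  record Copy : Set where
    constructor copy
    field
      end       : ∂̃
      index     : ℕ
      index<cap : [ index ] <⁺ cap end
  open Copy

  -- Equality of copies up to edgewise equality of rays and up to the proofs of the index bounds.
  Twin : Copy → Copy → Set
  Twin x y = Same (end x) (end y) × index x ≡ index y

  Twin-sym : ∀ x y → Twin x y → Twin y x
  Twin-sym x y (s , eq) = Same-sym (end x) (end y) s , sym eq

  -- Both indices are 0, as a ray has a single copy. Hence copies that are not twins have a finite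
  -- pairing.
  SameRay⇒Twin : ∀ x y → SameRay (end x) (end y) → Twin x y
  SameRay⇒Twin (copy (ray ρ) i [ i<1 ]) (copy (ray τ) j [ j<1 ]) s =
    s , ≡.trans (ℕ.n<1⇒n≡0 i<1) (sym (ℕ.n<1⇒n≡0 j<1))

  CommonEdge : Copy → Copy → E → Set
  CommonEdge x y = Common (end x) (end y)

  module A  = OrderedMonoid approxMonoid
  module A⁺ = OrderedMonoid (addTop approxMonoid)
  open AddSup≤ _≤ᵃ_ using ([_]; _≤⊤⁺; [≤]-injective)
  open A⁺ using (_≼_; ≼-refl; ≼-trans)

  edgeLength : List E → Approx
  edgeLength es = A.sum (List.map (seq ∘ length) es)

  edgeLength-mono : ∀ {es fs} {P Q : E → Set} → Enumerates es P → Enumerates fs Q →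
                    (∀ {e} → P e → Q e) → edgeLength es ≤ᵃ edgeLength fs
  edgeLength-mono (ue , es⇔P) (_ , fs⇔Q) P⊆Q =
    A.sum-⊆ (seq ∘ length) (λ e → <ℝ⇒≤ᵃ {0ℝ} {length e} (LengthFunction.positive ℓ e)) ue
      λ {e} → Equivalence.from (fs⇔Q e) ∘ P⊆Q ∘ Equivalence.to (es⇔P e)

  commonEdges : ∀ x y → ¬ Twin x y → ∃ λ es → Enumerates es (CommonEdge x y)
  commonEdges x y ¬t = Common-finite (end x) (end y) (¬t ∘ SameRay⇒Twin x y)

  -- Abstract, so that with-abstraction over em {Twin x y} leaves dist folded.
  abstract
    dist : Copy → Copy → Approx ⁺
    dist x y with em {Twin x y}
    ... | yes _ = ⊤⁺
    ... | no ¬t = [ edgeLength (proj₁ (commonEdges x y ¬t)) ]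

    dist-twin : ∀ x y → Twin x y → dist x y ≡ ⊤⁺
    dist-twin x y t with em {Twin x y}
    ... | yes _ = refl
    ... | no ¬t = contradiction t ¬t

    dist-finite : ∀ x y → ¬ Twin x y →
                  ∃ λ es → Enumerates es (CommonEdge x y) × dist x y ≡ [ edgeLength es ]
    dist-finite x y ¬t with em {Twin x y}
    ... | yes t  = contradiction t ¬t
    ... | no ¬t′ = proj₁ (commonEdges x y ¬t′) , proj₂ (commonEdges x y ¬t′) , refl

  -- The hypothesis is conditional because for twins `z` and `w` the right-hand side is `⊤⁺`.
  dist-mono : ∀ x y z w → (¬ Twin z w → ¬ Twin x y × (∀ {e} → CommonEdge x y e → CommonEdge z w e)) →
              dist x y ≼ dist z w
  dist-mono x y z w h with em {Twin z w}
  ... | yes t = subst (dist x y ≼_) (sym (dist-twin z w t)) (_ ≤⊤⁺)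
  ... | no ¬t =
    let es , enumₑ , eqₑ = dist-finite x y (proj₁ (h ¬t))
        fs , enumᶠ , eqᶠ = dist-finite z w ¬t
    in ≡.subst₂ _≼_ (sym eqₑ) (sym eqᶠ) [ edgeLength-mono {es} {fs} enumₑ enumᶠ (proj₂ (h ¬t)) ]

  dist-sym : ∀ x y → dist x y ≼ dist y x
  dist-sym x y = dist-mono x y y x λ ¬t → ¬t ∘ Twin-sym x y , Common-swap {end x} {end y}

  -- Apart from twins, the edges that `x` and `z` share with `y` form nested sets, and the smaller
  -- one is shared by `x` and `z`.
  dist-ultra : ∀ x y z → dist x y ≼ dist x z ⊎ dist y z ≼ dist x z
  dist-ultra x y z with em {Twin x z} | em {Twin x y} | em {Twin y z}
  ... | yes xz | _ | _ = inj₁ (dist-mono x y x z (contradiction xz))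
  ... | no ¬xz | yes (s , eq) | _ = inj₂ (dist-mono y z x z λ _ →
    (λ (s′ , eq′) → ¬xz (Same-trans (end x) (end y) (end z) s s′ , ≡.trans eq eq′))
    , λ (e∈y , e∈z) → Same-onPath (end y) (end x) (Same-sym (end x) (end y) s) e∈y , e∈z)
  ... | no ¬xz | no ¬xy | yes (s , _) = inj₁ (dist-mono x y x z λ _ →
    ¬xy , λ (e∈x , e∈y) → e∈x , Same-onPath (end y) (end z) s e∈y)
  ... | no ¬xz | no ¬xy | no ¬yz with Common-total (end x) (end z) (end y)
  ...   | inj₁ xy⊆zy = inj₁ (dist-mono x y x z λ _ → ¬xy , λ c → proj₁ c , proj₁ (xy⊆zy c))
  ...   | inj₂ zy⊆xy = inj₂ (dist-mono y z x z λ _ →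
    ¬yz , λ (e∈y , e∈z) → proj₁ (zy⊆xy (e∈z , e∈y)) , e∈z)

  dist-total : ∀ x y z → dist x z ≼ dist y z ⊎ dist y z ≼ dist x z
  dist-total x y z with em {Twin x z} | em {Twin y z}
  ... | yes xz | _      = inj₂ (dist-mono y z x z (contradiction xz))
  ... | no _   | yes yz = inj₁ (dist-mono x z y z (contradiction yz))
  ... | no ¬xz | no ¬yz with Common-total (end x) (end y) (end z)
  ...   | inj₁ xz⊆yz = inj₁ (dist-mono x z y z λ _ → ¬xz , xz⊆yz)
  ...   | inj₂ yz⊆xz = inj₂ (dist-mono y z x z λ _ → ¬yz , yz⊆xz)

  open Ultrametric (addTop approxMonoid) dist dist-sym dist-ultra dist-total public

  -- Agreement of path costs with copy costs.

  infix 4 _≃_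

  _≃_ : Approx ⁺ → Approx ⁺ → Set
  x ≃ y = x ≼ y × y ≼ x

  ≈ℝ⇒≃ : ∀ r s {t} → r ≈ℝ s → seq s ≡ t → [ t ] ≃ [ seq r ]
  ≈ℝ⇒≃ _ _ (r≤s , s≤r) refl = [ approx-≤ s≤r ] , [ approx-≤ r≤s ]

  pairing⇒dist : ∀ x y r → ¬ Twin x y → IsPairing T ℓ (end x) (end y) r → dist x y ≃ [ seq r ]
  pairing⇒dist x y r ¬t (es , enumₑ , r≈es) =
    let fs , enumᶠ , eq = dist-finite x y ¬t
        es≤r , r≤es     = ≈ℝ⇒≃ r (sumℝ (List.map length es)) r≈es (seq-sumℝ length es)
    in subst (_≃ [ seq r ]) (sym eq)
         ( ≼-trans [ edgeLength-mono enumᶠ enumₑ id ] es≤r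
         , ≼-trans r≤es [ edgeLength-mono enumₑ enumᶠ id ])

  ends : ∀ {n} → Vec Copy n → Vec ∂̃ n
  ends = Vec.map end

  HasTwinIn : Copy → ∀ {n} → Vec Copy n → Set
  HasTwinIn x = VecAny.Any (Twin x)

  cost-twin : ∀ x {n} (cs : Vec Copy n) → HasTwinIn x cs → cost x (Vec.toList cs) ≡ ⊤⁺
  cost-twin x (c ∷ cs) (VecAny.here t)  rewrite dist-twin x c t = refl
  cost-twin x (c ∷ cs) (VecAny.there a) rewrite cost-twin x cs a with dist x c
  ... | [ _ ] = refl
  ... | ⊤⁺    = refl

  isCost⇒cost : ∀ x {n} (cs : Vec Copy n) r → ¬ HasTwinIn x cs →
                IsCost T ℓ (end x) (ends cs) r → cost x (Vec.toList cs) ≃ [ seq r ]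
  isCost⇒cost x cs r ¬t (xs , pairings , r≈xs) =
    let le , ge     = pointwise cs xs ¬t pairings
        xs≤r , r≤xs = ≈ℝ⇒≃ r (sumℝ (Vec.toList xs)) r≈xs refl
    in ≼-trans le xs≤r , ≼-trans r≤xs ge
    where
    pointwise : ∀ {n} (cs : Vec Copy n) (xs : Vec ℝ n) → ¬ HasTwinIn x cs →
                Pointwise (IsPairing T ℓ (end x)) (ends cs) xs →
                cost x (Vec.toList cs) ≃ [ seq (sumℝ (Vec.toList xs)) ]
    pointwise []       []       _  []       = ≼-refl , ≼-refl
    pointwise (c ∷ cs) (r ∷ xs) ¬t (p ∷ ps) =
      let le₁ , ge₁ = pairing⇒dist x c r (¬t ∘ VecAny.here) p
          le₂ , ge₂ = pointwise cs xs (¬t ∘ VecAny.there) ps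
      in A⁺.+-mono le₁ le₂ , A⁺.+-mono ge₁ ge₂

  ≈ℝ-refl : ∀ r → r ≈ℝ r
  ≈ℝ-refl r = r≤r , r≤r
    where
    r≤r : r ≤ℝ r
    r≤r = _≤ᵃ_.eventually-≤ A.≼-refl

  -- `IsMinimizer` compares only with candidates whose cost is given, so a competitor must be
  -- supplied with one.
  isCost-exists : ∀ x {n} (cs : Vec Copy n) → ¬ HasTwinIn x cs → ∃ (IsCost T ℓ (end x) (ends cs))
  isCost-exists x cs ¬t =
    let xs , ps = pairings cs ¬t in sumℝ (Vec.toList xs) , xs , ps , ≈ℝ-refl (sumℝ (Vec.toList xs))
    where
    pairings : ∀ {n} (cs : Vec Copy n) → ¬ HasTwinIn x cs →
               ∃ λ (xs : Vec ℝ n) → Pointwise (IsPairing T ℓ (end x)) (ends cs) xs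
    pairings []       _  = [] , []
    pairings (c ∷ cs) ¬t =
      let es , enum = commonEdges x c (¬t ∘ VecAny.here)
          xs , ps   = pairings cs (¬t ∘ VecAny.there)
      in sumℝ (List.map length es) ∷ xs , (es , enum , ≈ℝ-refl (sumℝ (List.map length es))) ∷ ps

  -- From greedy sequences of paths to greedy orders of copies.

  -- The copies of τ in cs are exactly those with the lowest indices.
  Consecutive : ∀ {n} → Vec Copy n → Set
  Consecutive cs = ∀ x → (index x ℕ.< count (end x) (ends cs) → HasTwinIn x cs)
                       × (HasTwinIn x cs → index x ℕ.< count (end x) (ends cs))

  nextCopy : ∀ {n} (cs : Vec Copy n) ρ → Admissible T χ (ends cs) ρ → Copy
  nextCopy cs ρ adm = copy ρ (count ρ (ends cs)) (admissible⇒count<cap (ends cs) ρ adm)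

  nextCopy-consecutive : ∀ {n} (cs : Vec Copy n) ρ adm → Consecutive cs →
                         Consecutive (nextCopy cs ρ adm ∷ cs)
  nextCopy-consecutive cs ρ adm cons x = to , from
    where
    ρs = ends cs
    to : index x ℕ.< count (end x) (ρ ∷ ρs) → HasTwinIn x (nextCopy cs ρ adm ∷ cs)
    to lt with em {Same (end x) ρ}
    ... | no _  = VecAny.there (proj₁ (cons x) lt)
    ... | yes s with ℕ.m≤n⇒m<n∨m≡n (ℕ.≤-pred lt)
    ...   | inj₁ lt′ = VecAny.there (proj₁ (cons x) lt′)
    -- The index equals the old count, so `x` is a twin of the new copy.
    ...   | inj₂ eq  = VecAny.here (s , ≡.trans eq (count-cong (end x) ρ ρs s))
    from : HasTwinIn x (nextCopy cs ρ adm ∷ cs) → index x ℕ.< count (end x) (ρ ∷ ρs)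
    from (VecAny.there a) = ℕ.<-≤-trans (proj₂ (cons x) a) (count-∷-≤ (end x) ρ ρs)
    from (VecAny.here (s , eq)) = ℕ.≤-reflexive (begin
      ℕ.suc (index x)              ≡⟨ cong ℕ.suc eq ⟩
      ℕ.suc (count ρ ρs)           ≡⟨ cong ℕ.suc (count-cong (end x) ρ ρs s) ⟨
      ℕ.suc (count (end x) ρs)     ≡⟨ count-∷-same (end x) ρ ρs s ⟨
      count (end x) (ρ ∷ ρs)       ∎)
      where open ≡.≡-Reasoning

  -- A twin in `cs` would force the index of the new copy below the count of its end, which is that
  -- index.
  nextCopy-fresh : ∀ {n} (cs : Vec Copy n) ρ adm → Consecutive cs → ¬ HasTwinIn (nextCopy cs ρ adm) cs
  nextCopy-fresh cs ρ adm cons t = ℕ.<-irrefl refl (proj₂ (cons (nextCopy cs ρ adm)) t)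

  -- A competitor with a twin in `cs` has infinite cost; any other has an admissible end, to which
  -- greediness applies.
  nextCopy-minimal : ∀ {n} (cs : Vec Copy n) ρ adm → Consecutive cs → Greedy T ℓ χ (ρ ∷ ends cs) →
                     ∀ y → cost (nextCopy cs ρ adm) (Vec.toList cs) ≼ cost y (Vec.toList cs)
  nextCopy-minimal []         ρ adm cons _                                _ = ≼-refl
  nextCopy-minimal cs@(_ ∷ _) ρ adm cons ((_ , x , isCost , minimal) , _) y = compare em
    where
    compare : Dec (HasTwinIn y cs) → cost (nextCopy cs ρ adm) (Vec.toList cs) ≼ cost y (Vec.toList cs)
    compare (yes t) = subst (cost (nextCopy cs ρ adm) (Vec.toList cs) ≼_) (sym (cost-twin y cs t)) (_ ≤⊤⁺)
    compare (no ¬t) =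
      let r , isCostʸ = isCost-exists y cs ¬t
          -- Without a twin in `cs`, the index of `y` is at least the count of its end, so that
          -- count is below the capacity.
          admʸ        = count<cap⇒admissible (ends cs) (end y)
                          (≤-<⁺-trans (ℕ.≮⇒≥ (¬t ∘ proj₁ (cons y))) (index<cap y))
          cost≤x , _  = isCost⇒cost (nextCopy cs ρ adm) cs x (nextCopy-fresh cs ρ adm cons) isCost
          _ , r≤cost  = isCost⇒cost y cs r ¬t isCostʸ
      in ≼-trans cost≤x (≼-trans [ approx-≤ (minimal (end y) r admʸ isCostʸ) ] r≤cost)

  greedy⇒copies : ∀ {n} (ρs : Vec ∂̃ n) → Greedy T ℓ χ ρs → ∃ λ (cs : Vec Copy n) →
                  ends cs ≡ ρs × Consecutive cs × GreedyOrder (Vec.toList cs)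
  greedy⇒copies []       _ = [] , refl , (λ _ → (λ ()) , λ ()) , tt
  greedy⇒copies (ρ ∷ ρs) g with greedy⇒copies ρs (greedy-tail ρs g)
  ... | cs , refl , cons , order =
    nextCopy cs ρ adm ∷ cs , refl , nextCopy-consecutive cs ρ adm cons
    , nextCopy-minimal cs ρ adm cons g , order
    where adm = greedy⇒admissible (ends cs) g

  factorial⇒copies : ∀ {n} x → IsFactorial T ℓ χ n x → ∃₂ λ c (cs : Vec Copy n) →
                     GreedyOrder (c ∷ Vec.toList cs) × cost c (Vec.toList cs) ≃ [ seq x ]
  factorial⇒copies x (ρ , ρs , g , isCost) =
    let cs , ends≡ρs , cons , order = greedy⇒copies ρs (greedy-tail ρs g)
    in extendCopies cs ends≡ρs cons order g isCost
    where
    extendCopies : ∀ {n} {ρs : Vec ∂̃ n} (cs : Vec Copy n) → ends cs ≡ ρs → Consecutive cs →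
                   GreedyOrder (Vec.toList cs) → Greedy T ℓ χ (ρ ∷ ρs) → IsCost T ℓ ρ ρs x →
                   ∃₂ λ c (cs : Vec Copy n) →
                   GreedyOrder (c ∷ Vec.toList cs) × cost c (Vec.toList cs) ≃ [ seq x ]
    extendCopies cs refl cons order g isCost =
      nextCopy cs ρ adm , cs , (nextCopy-minimal cs ρ adm cons g , order)
      , isCost⇒cost (nextCopy cs ρ adm) cs x (nextCopy-fresh cs ρ adm cons) isCost
      where adm = greedy⇒admissible (ends cs) g

  -- Superadditivity of the factorials.

  factorial-superadditive : ∀ {n k m} x y z → n ≡ k ℕ.+ m →
    IsFactorial T ℓ χ n x → IsFactorial T ℓ χ k y → IsFactorial T ℓ χ m z → y +ℝ z ≤ℝ x
  factorial-superadditive x y z n≡k+m n! k! m! =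
    let _ , ws , orderʷ , costʷ≤x , _ = factorial⇒copies x n!
        _ , us , orderᵘ , _ , y≤costᵘ = factorial⇒copies y k!
        _ , vs , orderᵛ , _ , z≤costᵛ = factorial⇒copies z m!
        lengths = ≡.trans (Vec.length-toList ws) (≡.trans n≡k+m
                    (sym (≡.cong₂ ℕ._+_ (Vec.length-toList us) (Vec.length-toList vs))))
    -- All three values are finite, so the inequality descends from the extended monoid.
    in _≤ᵃ_.eventually-≤ ([≤]-injective (
         ≼-trans (A⁺.+-mono y≤costᵘ z≤costᵛ) (
         ≼-trans (greedy-superadditive orderʷ orderᵘ orderᵛ lengths)
         costʷ≤x)))

proposition2p11 : ExcludedMiddle 0ℓ →
    (T : LocallyFiniteRootedTree) (ℓ : LengthFunction T) (χ : CapacityFunction T) →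
    (N : ℕ∞) → IsN T χ N →
    (n m : ℕ) → m ≤ n → [ n ] <⁺ N →
    (x y z : ℝ) → IsFactorial T ℓ χ n x → IsFactorial T ℓ χ (n ∸ m) y → IsFactorial T ℓ χ m z →
    y +ℝ z ≤ℝ x
proposition2p11 em T ℓ χ _ _ n m m≤n _ x y z =
  Copies.factorial-superadditive em T ℓ χ x y z (sym (ℕ.m∸n+n≡m m≤n))
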